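{- Let $a\geq 2$ be an integer and let $D$ be a balanced bipartite digraph with colour classes $X$ and $Y$, where $|X|=|Y|=a$. Suppose that $D$ satisfies condition $A^*_2$, i.e. \[ d^+(u)+d^-(v)\geq a+2 \] for all vertices $u$ and $v$ from opposite colour classes (that is, $u\in X,\ v\in Y$ or $u\in Y,\ v\in X$) such that $uv\notin A(D)$. Then $D$ contains an oriented cycle of length $2a$.
   Context: A digraph $D$ is a pair $(V(D),A(D))$ with $V(D)$ a finite set of vertices and $A(D)$ a set of ordered pairs of distinct vertices, called arcs (no loops, no multiple arcs; both $uv$ and $vu$ may be arcs). We write $uv\in A(D)$ for $(u,v)\in A(D)$. $D$ is bipartite with colour classes $X$ and $Y$ if $V(D)$ is the disjoint union of $X$ and $Y$ and no arc has both ends in $X$ or both ends in $Y$; it is balanced if $|X|=|Y|$. For a vertex $v$, $d^+(v)$ is the number of vertices $u$ with $vu\in A(D)$, and $d^-(v)$ is the number of vertices $u$ with $uv\in A(D)$. An oriented cycle of length $m$ consists of pairwise distinct vertices $v_1,\dots,v_m$ with $v_iv_{i+1}\in A(D)$ for $1\le i<m$ and $v_mv_1\in A(D)$. -}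

module Defs where

open import Data.Fin.Base using (Fin; toℕ)
open import Data.Fin.Subset using (Subset; _∈_; _∉_; ∣_∣)
open import Data.Nat.Base using (ℕ; suc; NonZero; _+_; _≥_)
open import Data.Product.Base using (_×_)
open import Data.Sum.Base using (_⊎_)
open import Data.Vec.Base using (tabulate)
open import Function.Definitions using (Injective)
open import Level using (0ℓ)
open import Relation.Binary.Core using (Rel)
open import Relation.Binary.Definitions using (Decidable)
open import Relation.Binary.PropositionalEquality.Core using (_≡_)
open import Relation.Nullary using (¬_; does)

-- The set of arcs is a decidable relation on the vertices; only whether
-- u ⟶ v is inhabited matters, so there are no multiple arcs.
record Digraph : Set₁ where
  infix 4 _⟶_ _⟶?_
  field
    order    : ℕ
    _⟶_      : Rel (Fin order) 0ℓ
    _⟶?_     : Decidable _⟶_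
    loopless : ∀ v → ¬ (v ⟶ v)

  Vertex : Set
  Vertex = Fin order

  N⁺ N⁻ : Vertex → Subset order
  N⁺ v = tabulate (λ u → does (v ⟶? u))
  N⁻ v = tabulate (λ u → does (u ⟶? v))

  d⁺ d⁻ : Vertex → ℕ
  d⁺ v = ∣ N⁺ v ∣
  d⁻ v = ∣ N⁻ v ∣

module _ (D : Digraph) where
  open Digraph D

  record IsBipartition (X Y : Subset order) : Set where
    field
      covers   : ∀ v → v ∈ X ⊎ v ∈ Y
      disjoint : ∀ v → v ∈ X → v ∉ Y
      noArcX   : ∀ {u v} → u ∈ X → v ∈ X → ¬ (u ⟶ v)
      noArcY   : ∀ {u v} → u ∈ Y → v ∈ Y → ¬ (u ⟶ v)

  OppositeClasses : (X Y : Subset order) → Rel Vertex 0ℓ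
  OppositeClasses X Y u v = (u ∈ X × v ∈ Y) ⊎ (u ∈ Y × v ∈ X)

  ConditionA*₂ : (a : ℕ) (X Y : Subset order) → Set
  ConditionA*₂ a X Y =
    ∀ u v → OppositeClasses X Y u v → ¬ (u ⟶ v) → d⁺ u + d⁻ v ≥ a + 2

  -- The vertices v₁, …, vₘ are indexed from 0, so vᵢ is  vertex (i - 1).
  record OrientedCycle (m : ℕ) : Set where
    field
      nonEmpty : NonZero m
      vertex   : Fin m → Vertex
      distinct : Injective _≡_ _≡_ vertex
      step     : ∀ i j → toℕ j ≡ suc (toℕ i) → vertex i ⟶ vertex j
      close    : ∀ first last → toℕ first ≡ 0 → suc (toℕ last) ≡ m →
                 vertex last ⟶ vertex first

{-# OPTIONS --safe #-}
-- A perfect matching M of arcs from X to Y exists by augmentation along paths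
-- with three arcs.  Contract it: put an arc from (x , y) to (x′ , y′) whenever
-- y ⟶ x′ (loops allowed).  The contracted digraph on n = a vertices satisfies
-- d⁺ u + d⁻ v ≥ n + 2 for all non-arcs (u , v), including u = v, and each of its
-- Hamiltonian cycles expands to a cycle of length 2a of D.
--
-- For the contracted digraph (a form of Woodall's theorem), take a longest cycle
-- and a detour y … y′ outside it that leaves at e′ and returns at e such that the
-- part p … p′ of the cycle between e′ and e is shortest.  Then (y′ , p) and (p′ , y)
-- are not arcs, so the four degrees d⁺ y′, d⁻ p, d⁺ p′, d⁻ y add up to at least
-- 2n + 4.  But a vertex x off the part e … e′ of the cycle contributes at most one
-- to d⁺ y′ + d⁻ p and at most one to d⁺ p′ + d⁻ y, and on the path e … e′ neither
-- p … p′ nor y … y′ can be inserted, so the sum is at most 2n + 2.  Every failure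
-- of one of these bounds is a longer cycle or a shorter gap, which makes the
-- argument an algorithm.
module Submission where

open import Defs
import Algebra.Solver.CommutativeMonoid as CommutativeMonoidSolver
open import Data.Bool.Base using (true; false)
open import Data.Fin.Base using (Fin; zero; suc; toℕ)
import Data.Fin.Subset as Subset
open import Data.Fin.Subset using (Subset; ∣_∣)
open import Data.Fin.Subset.Properties using (_∈?_)
open import Data.List.Base
  using (List; []; _∷_; [_]; _++_; length; filter; map; concatMap; tabulate; allFin; lookup)
open import Data.List.Membership.Propositional using (_∈_; find)
open import Data.List.Membership.Propositional.Properties
  using (∈-∃++; ∈-++⁻; ∈-++⁺ʳ; ∈-lookup; ∈-filter⁻)
import Data.List.Properties as List
open import Data.List.Properties
  using (filter-++; filter-none; length-++; length-filter; length-map)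
open import Data.List.Relation.Binary.Permutation.Propositional
  using (_↭_; ↭-refl; ↭-sym; ↭-trans; prep; swap; ↭⇒↭ₛ)
open import Data.List.Relation.Binary.Permutation.Propositional.Properties
  using (++-commutativeMonoid; ++-comm; ++-identityʳ; ++⁺; ++⁺ˡ; filter-↭; map⁺; shift;
         ↭-length; ∈-resp-↭)
import Data.List.Relation.Binary.Permutation.Setoid.Properties as Permutation
import Data.List.Relation.Unary.All as All
open import Data.List.Relation.Unary.All using (All)
open import Data.List.Relation.Unary.All.Properties using (all-filter; ¬Any⇒All¬)
open import Data.List.Relation.Unary.AllPairs using (_∷_)
open import Data.List.Relation.Unary.Any using (Any; here; there; any?)
open import Data.List.Relation.Unary.Unique.Propositional using (Unique)
open import Data.List.Relation.Unary.Unique.Propositional.Properties using (allFin⁺)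
open import Data.Nat.Base
  using (ℕ; zero; suc; _+_; _*_; _≤_; _<_; _≥_; z≤n; s≤s; s≤s⁻¹; >-nonZero)
open import Data.Nat.Properties
open import Data.Nat.Tactic.RingSolver using (solve-∀)
open import Data.Product.Base using (_×_; _,_; ∃; ∃₂; proj₂)
open import Data.Sum.Base using (_⊎_; inj₁; inj₂; [_,_]′; map₁)
import Data.Vec.Base as Vec
open import Data.Vec.Properties using (lookup∘tabulate)
open import Function.Base using (id; _∘_)
open import Function.Definitions using (Injective)
open import Level using (0ℓ)
open import Relation.Binary.Core using (Rel)
import Relation.Binary.Definitions as Binary
open import Relation.Binary.PropositionalEquality.Core
  using (_≡_; refl; sym; trans; cong; cong₂; subst; subst₂)
open import Relation.Binary.PropositionalEquality.Properties using (setoid)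
open import Relation.Nullary using (¬_; Dec; yes; no; does; contradiction)
open import Relation.Unary using (Pred; Decidable)

-- Counting in lists

module _ {A : Set} where

  count : {P : Pred A 0ℓ} → Decidable P → List A → ℕ
  count P? xs = length (filter P? xs)

  module _ {P : Pred A 0ℓ} (P? : Decidable P) where

    count-++ : ∀ xs ys → count P? (xs ++ ys) ≡ count P? xs + count P? ys
    count-++ xs ys = trans (cong length (filter-++ P? xs ys)) (length-++ (filter P? xs))

    count-↭ : ∀ {xs ys} → xs ↭ ys → count P? xs ≡ count P? ys
    count-↭ xs↭ys = ↭-length (filter-↭ P? xs↭ys)

  -- An element with at most one of the two properties adds at most one to the sum. The disjunction
  -- turns each failure of the bound into a witness that a construction can use.
  common : {P Q : Pred A 0ℓ} (P? : Decidable P) (Q? : Decidable Q) → ∀ xs →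
    (∃ λ x → x ∈ xs × P x × Q x) ⊎ count P? xs + count Q? xs ≤ length xs
  common P? Q? [] = inj₂ z≤n
  common P? Q? (x ∷ xs) with common P? Q? xs
  ... | inj₁ (v , v∈xs , both) = inj₁ (v , there v∈xs , both)
  ... | inj₂ le with P? x | Q? x
  ...   | yes Px | yes Qx = inj₁ (x , here refl , Px , Qx)
  ...   | yes _  | no _   = inj₂ (s≤s le)
  ...   | no _   | yes _  = inj₂ (≤-trans (≤-reflexive (+-suc _ _)) (s≤s le))
  ...   | no _   | no _   = inj₂ (m≤n⇒m≤1+n le)

  common-exists : {P Q : Pred A 0ℓ} (P? : Decidable P) (Q? : Decidable Q) → ∀ xs →
    length xs < count P? xs + count Q? xs → ∃ λ x → x ∈ xs × P x × Q x
  common-exists P? Q? xs lt = [ id , (λ le → contradiction lt (≤⇒≯ le)) ]′ (common P? Q? xs)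

  extract : ∀ {x} {xs : List A} → x ∈ xs → ∃ λ ys → xs ↭ x ∷ ys
  extract x∈xs with ∈-∃++ x∈xs
  ... | ys , zs , refl = ys ++ zs , shift _ ys zs

count-map : ∀ {A B : Set} {P : Pred B 0ℓ} (P? : Decidable P) (f : A → B) xs →
  count P? (map f xs) ≡ count (λ x → P? (f x)) xs
count-map P? f [] = refl
count-map P? f (x ∷ xs) with P? (f x)
... | yes _ = cong suc (count-map P? f xs)
... | no _  = count-map P? f xs

count-none : ∀ {A : Set} {P : Pred A 0ℓ} (P? : Decidable P) {xs} →
  All (¬_ ∘ P) xs → count P? xs ≡ 0
count-none P? none = cong length (filter-none P? none)

-- Paths and cycles in a digraph with loops

module Woodall {A : Set} (_⟶_ : Rel A 0ℓ) (_⟶?_ : Binary.Decidable _⟶_) where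

  open CommutativeMonoidSolver (++-commutativeMonoid {A = A}) using (solve; _⊕_; _⊜_)

  -- Only arcs are recorded; distinctness comes later, from a permutation of a list without
  -- repetitions. With `only`, a loop closes a cycle of length one.
  data Path : List A → A → A → Set where
    only : ∀ {u} → Path [ u ] u u
    _∷_  : ∀ {xs u v w} → u ⟶ v → Path xs v w → Path (u ∷ xs) u w

  private variable
    xs ys : List A
    u v w t : A
    k : ℕ

  join : Path xs u v → v ⟶ w → Path ys w t → Path (xs ++ ys) u t
  join only    a q = a ∷ q
  join (b ∷ p) a q = b ∷ join p a q

  path-nonempty : Path xs u v → 1 ≤ length xs
  path-nonempty only    = s≤s z≤n
  path-nonempty (_ ∷ _) = s≤s z≤n

  start∈ : Path xs u v → u ∈ xs
  start∈ only    = here refl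
  start∈ (_ ∷ _) = here refl

  cutBefore : v ∈ xs → Path xs u w →
    u ≡ v ⊎
    (∃₂ λ ys zs → ∃ λ v⁻ → xs ≡ ys ++ zs × Path ys u v⁻ × v⁻ ⟶ v × Path zs v w)
  cutBefore (here refl) only    = inj₁ refl
  cutBefore (here refl) (_ ∷ _) = inj₁ refl
  cutBefore (there v∈xs) (a ∷ p) with cutBefore v∈xs p
  ... | inj₁ refl = inj₂ ([ _ ] , _ , _ , refl , only , a , p)
  ... | inj₂ (ys , zs , v⁻ , refl , q , b , r) =
    inj₂ (_ ∷ ys , zs , v⁻ , refl , a ∷ q , b , r)

  cutAfter : v ∈ xs → Path xs u w →
    v ≡ w ⊎
    (∃₂ λ ys zs → ∃ λ v⁺ → xs ≡ ys ++ zs × Path ys u v × v ⟶ v⁺ × Path zs v⁺ w)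
  cutAfter (here refl) only    = inj₁ refl
  cutAfter (here refl) (a ∷ p) = inj₂ ([ _ ] , _ , _ , refl , only , a , p)
  cutAfter (there v∈xs) (a ∷ p) with cutAfter v∈xs p
  ... | inj₁ v≡w = inj₁ v≡w
  ... | inj₂ (ys , zs , v⁺ , refl , q , b , r) =
    inj₂ (_ ∷ ys , zs , v⁺ , refl , a ∷ q , b , r)

  prefixTo : v ∈ xs → Path xs u w → ∃₂ λ ys zs → xs ≡ ys ++ zs × Path ys u v
  prefixTo v∈xs p with cutAfter v∈xs p
  ... | inj₁ refl = _ , [] , sym (List.++-identityʳ _) , p
  ... | inj₂ (ys , zs , _ , eq , q , _) = ys , zs , eq , q

  suffixFrom : v ∈ xs → Path xs u w → ∃₂ λ ys zs → xs ≡ ys ++ zs × Path zs v w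
  suffixFrom v∈xs p with cutBefore v∈xs p
  ... | inj₁ refl = [] , _ , refl , p
  ... | inj₂ (ys , zs , _ , eq , _ , _ , q) = ys , zs , eq , q

  -- A path on n vertices has n - 1 arcs, each of which carries at most one of
  -- "P at its tail" and "Q at its head"; only P at the last vertex and Q at the
  -- first one are left over.
  crossing : {P Q : Pred A 0ℓ} (P? : Decidable P) (Q? : Decidable Q) → Path xs u w →
    (∃₂ λ ys zs → ∃₂ λ v v⁺ →
       xs ≡ ys ++ zs × Path ys u v × P v × Q v⁺ × Path zs v⁺ w)
    ⊎ count P? xs + count Q? xs ≤ suc (length xs)
  crossing {xs} {u} {w} {P} {Q} P? Q? p = [ inj₁ , (λ le → inj₂ (≤-trans le bound)) ]′ (go p)
    where
    bound : length xs + count Q? [ u ] ≤ suc (length xs)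
    bound = ≤-trans (+-monoʳ-≤ (length xs) (length-filter Q? [ u ])) (≤-reflexive (+-comm _ 1))

    shuffle : ∀ a b c d → (a + b) + (c + d) ≡ (a + c) + (b + d)
    shuffle = solve-∀

    -- `Q` at the first vertex stays an exact term, because an arc put in front pairs it with `P` at
    -- its tail.
    go : ∀ {xs u} → Path xs u w →
      (∃₂ λ ys zs → ∃₂ λ v v⁺ →
         xs ≡ ys ++ zs × Path ys u v × P v × Q v⁺ × Path zs v⁺ w)
      ⊎ count P? xs + count Q? xs ≤ length xs + count Q? [ u ]
    go {u = u} only = inj₂ (+-monoˡ-≤ (count Q? [ u ]) (length-filter P? [ u ]))
    go (_∷_ {xs} {u} {v} a p) with go p
    ... | inj₁ (ys , zs , x , y , refl , q , Px , Qy , r) =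
      inj₁ (_ ∷ ys , zs , x , y , refl , a ∷ q , Px , Qy , r)
    -- The constant predicate asks about both ends of the new arc at once: `P` at `u` and `Q` at
    -- `v`.
    ... | inj₂ le with common P? (λ _ → Q? v) [ u ]
    ...   | inj₁ (_ , here refl , Pu , Qv) =
      inj₁ ([ _ ] , _ , _ , _ , refl , only , Pu , Qv , p)
    ...   | inj₂ le₁ = inj₂ (begin
      count P? (u ∷ xs) + count Q? (u ∷ xs)
        ≡⟨ cong₂ _+_ (count-++ P? [ u ] xs) (count-++ Q? [ u ] xs) ⟩
      (count P? [ u ] + count P? xs) + (count Q? [ u ] + count Q? xs)
        ≡⟨ shuffle (count P? [ u ]) _ _ _ ⟩
      (count P? [ u ] + count Q? [ u ]) + (count P? xs + count Q? xs)
        ≤⟨ +-monoʳ-≤ (count P? [ u ] + count Q? [ u ]) le ⟩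
      (count P? [ u ] + count Q? [ u ]) + (length xs + count Q? [ v ])
        ≡⟨ shuffle′ (count P? [ u ]) _ _ _ ⟩
      (count P? [ u ] + count Q? [ v ]) + (length xs + count Q? [ u ])
        ≤⟨ +-monoˡ-≤ _ (subst (λ n → count P? [ u ] + n ≤ 1) same le₁) ⟩
      suc (length xs) + count Q? [ u ] ∎)
      where
      open ≤-Reasoning
      shuffle′ : ∀ a b c d → (a + b) + (c + d) ≡ (a + d) + (c + b)
      shuffle′ = solve-∀
      same : count (λ (_ : A) → Q? v) [ u ] ≡ count Q? [ v ]
      same with Q? v
      ... | yes _ = refl
      ... | no _  = refl

  -- The cycle is cut open just behind `v`; unless `v` was already last, the old closing arc becomes
  -- an inner one.
  rotate : v ∈ xs → Path xs u w → w ⟶ u →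
    ∃₂ λ ys v⁺ → Path ys v⁺ v × v ⟶ v⁺ × ys ↭ xs
  rotate v∈xs p w⟶u with cutAfter v∈xs p
  ... | inj₁ refl = _ , _ , p , w⟶u , ↭-refl
  ... | inj₂ (xs₁ , xs₂ , v⁺ , refl , p₁ , a , p₂) =
    xs₂ ++ xs₁ , v⁺ , join p₂ w⟶u p₁ , a , ++-comm xs₂ xs₁

  -- Enlarging cycles under the degree condition

  module _ (L : List A)
    (degree : ∀ u v → ¬ (u ⟶ v) →
      length L + 2 ≤ count (u ⟶?_) L + count (_⟶? v) L) where

    -- `k` is only an upper bound, so constructions that gain different numbers of vertices share
    -- one type.
    record CycleMissing (k : ℕ) : Set where
      constructor cycle
      field
        {on off}  : List A
        {start end} : A
        path      : Path on start end
        close     : end ⟶ start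
        partition : on ++ off ↭ L
        few       : length off ≤ k

    -- The degree sum exceeds the number of vertices, so the two neighbourhoods meet. The case
    -- `u = v` is included and yields two-cycles.
    between : ¬ (u ⟶ v) → ∃ λ w → w ∈ L × u ⟶ w × w ⟶ v
    between {u} {v} u↛v = common-exists (u ⟶?_) (_⟶? v) L
      (<-≤-trans (m<m+n (length L) (s≤s z≤n)) (degree u v u↛v))

    -- The cycle P ++ E together with a detour Y from the last vertex of E to the
    -- first one, whose gap P is to be shortened.
    record Bypass (k : ℕ) : Set where
      constructor bypass
      field
        {P E Y Z}        : List A
        {p p′ e e′ y y′} : A
        pathP            : Path P p p′
        pathE            : Path E e e′
        pathY            : Path Y y y′
        p′⟶e             : p′ ⟶ e
        e′⟶p             : e′ ⟶ p
        e′⟶y             : e′ ⟶ y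
        y′⟶e             : y′ ⟶ e
        partition        : P ++ (E ++ (Y ++ Z)) ↭ L
        few              : length (Y ++ Z) ≤ suc k

    private
      fewer : ∀ {W k Y R} → W ↭ Y ++ R → Path Y u v → length W ≤ suc k → length R ≤ k
      fewer {Y = Y} {R} W↭ q le = s≤s⁻¹ (≤-trans (+-monoˡ-≤ (length R) (path-nonempty q))
        (≤-trans (≤-reflexive (trans (sym (length-++ Y)) (sym (↭-length W↭)))) le))

    private
      _or_ : ∀ {T B : Set} → T ⊎ B → (B → T) → T
      x or f = [ id , f ]′ x

    -- Recursion on a bound `m` for the gap. Every cycle returned contains `P`, `E` and a nonempty
    -- part of `Y`, hence misses at most `k` vertices.
    shorten : ∀ m (b : Bypass k) → length (Bypass.P b) ≤ m → CycleMissing k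
    shorten zero b le = contradiction (≤-trans (path-nonempty (Bypass.pathP b)) le) 1+n≰n
    shorten {k} (suc m) (bypass {P} {E} {Y} {Z} {p} {p′} {e} {e′} {y} {y′}
                     pathP pathE pathY p′⟶e e′⟶p e′⟶y y′⟶e partition few) le
      with y′ ⟶? p | p′ ⟶? y
    ... | yes y′⟶p | _ =
      cycle (join pathP p′⟶e (join pathE e′⟶y pathY)) y′⟶p
        (↭-trans (solve 4 (λ P E Y Z → (P ⊕ (E ⊕ Y)) ⊕ Z ⊜ P ⊕ (E ⊕ (Y ⊕ Z))) ↭-refl P E Y Z) partition)
        (fewer ↭-refl pathY few)
    ... | no _ | yes p′⟶y =
      cycle (join pathP p′⟶y (join pathY y′⟶e pathE)) e′⟶p
        (↭-trans (solve 4 (λ P E Y Z → (P ⊕ (Y ⊕ E)) ⊕ Z ⊜ P ⊕ (E ⊕ (Y ⊕ Z))) ↭-refl P E Y Z) partition)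
        (fewer ↭-refl pathY few)
    ... | no y′↛p | no p′↛y =
      -- On `P`, `Y` and `Z` the degrees are paired as in the two non-arcs; on `E` they are paired
      -- crosswise, as insertion of `Y` or of `P` between consecutive vertices requires. Each test
      -- either ends the search or hands on its bound.
      map₁ fromP₁ (common (y′ ⟶?_) (_⟶? p) P) or λ P₁ →
      map₁ fromP₂ (common (p′ ⟶?_) (_⟶? y) P) or λ P₂ →
      map₁ fromE₁ (crossing (_⟶? y) (y′ ⟶?_) pathE) or λ E₁ →
      map₁ fromE₂ (crossing (_⟶? p) (p′ ⟶?_) pathE) or λ E₂ →
      map₁ fromY₁ (common (y′ ⟶?_) (_⟶? p) Y) or λ Y₁ →
      map₁ fromY₂ (common (p′ ⟶?_) (_⟶? y) Y) or λ Y₂ →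
      map₁ fromZ₁ (common (y′ ⟶?_) (_⟶? p) Z) or λ Z₁ →
      map₁ fromZ₂ (common (p′ ⟶?_) (_⟶? y) Z) or λ Z₂ →
      contradiction (+-mono-≤ (degree y′ p y′↛p) (degree p′ y p′↛y))
        (<⇒≱ (begin-strict
          count (y′ ⟶?_) L + count (_⟶? p) L + (count (p′ ⟶?_) L + count (_⟶? y) L)
            ≡⟨ cong₂ _+_ (cong₂ _+_ (parts (y′ ⟶?_)) (parts (_⟶? p)))
                         (cong₂ _+_ (parts (p′ ⟶?_)) (parts (_⟶? y))) ⟩
          _ ≡⟨ regroup (#P (y′ ⟶?_)) (#E (y′ ⟶?_)) (#Y (y′ ⟶?_)) (#Z (y′ ⟶?_))
                       (#P (_⟶? p)) (#E (_⟶? p)) (#Y (_⟶? p)) (#Z (_⟶? p))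
                       (#P (p′ ⟶?_)) (#E (p′ ⟶?_)) (#Y (p′ ⟶?_)) (#Z (p′ ⟶?_))
                       (#P (_⟶? y)) (#E (_⟶? y)) (#Y (_⟶? y)) (#Z (_⟶? y)) ⟩
          _ ≤⟨ +-mono-≤ (+-mono-≤ (+-mono-≤ P₁ P₂) (+-mono-≤ E₁ E₂))
                        (+-mono-≤ (+-mono-≤ Y₁ Y₂) (+-mono-≤ Z₁ Z₂)) ⟩
          -- The bounds add up to `2 * length L + 2`, the 2 coming from the two `crossing` tests on
          -- `E`; the degree condition demands 2 more.
          _ <⟨ m<m+n _ (s≤s (z≤n {1})) ⟩
          _ ≡⟨ total (length P) (length E) (length Y) (length Z) ⟩
          _ ≡⟨ cong (λ n → (n + 2) + (n + 2)) lengths ⟨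
          length L + 2 + (length L + 2) ∎))
      where
      open ≤-Reasoning

      #P #E #Y #Z : ∀ {Q : Pred A 0ℓ} → Decidable Q → ℕ
      #P Q? = count Q? P
      #E Q? = count Q? E
      #Y Q? = count Q? Y
      #Z Q? = count Q? Z

      parts : ∀ {Q : Pred A 0ℓ} (Q? : Decidable Q) → count Q? L ≡ #P Q? + (#E Q? + (#Y Q? + #Z Q?))
      parts Q? = trans (sym (count-↭ Q? partition))
        (trans (count-++ Q? P _) (cong (#P Q? +_)
        (trans (count-++ Q? E _) (cong (#E Q? +_) (count-++ Q? Y Z)))))

      lengths : length L ≡ length P + (length E + (length Y + length Z))
      lengths = trans (sym (↭-length partition))
        (trans (length-++ P) (cong (length P +_)
        (trans (length-++ E) (cong (length E +_) (length-++ Y)))))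

      regroup : ∀ P₁ E₁ Y₁ Z₁ P₂ E₂ Y₂ Z₂ P₃ E₃ Y₃ Z₃ P₄ E₄ Y₄ Z₄ →
        P₁ + (E₁ + (Y₁ + Z₁)) + (P₂ + (E₂ + (Y₂ + Z₂)))
          + (P₃ + (E₃ + (Y₃ + Z₃)) + (P₄ + (E₄ + (Y₄ + Z₄))))
        ≡ (P₁ + P₂ + (P₃ + P₄) + (E₄ + E₁ + (E₂ + E₃)))
          + (Y₁ + Y₂ + (Y₃ + Y₄) + (Z₁ + Z₂ + (Z₃ + Z₄)))
      regroup = solve-∀

      total : ∀ p e y z →
        (p + p + (suc e + suc e)) + (y + y + (z + z)) + 2
        ≡ (p + (e + (y + z)) + 2) + (p + (e + (y + z)) + 2)
      total = solve-∀

      shorter : ∀ {P₁ P₂} n → P ≡ P₁ ++ P₂ → n < length (P₁ ++ P₂) → n ≤ m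
      shorter n eq lt = s≤s⁻¹ (≤-trans lt (subst (λ xs → length xs ≤ suc m) eq le))

      -- Returning at `x` instead of `e` moves the part of `P` from `x` on to the front of `E`. What
      -- precedes `x` is the new gap, nonempty since `y′↛p` excludes `x = p`.
      fromP₁ : (∃ λ x → x ∈ P × y′ ⟶ x × x ⟶ p) → CycleMissing k
      fromP₁ (x , x∈P , y′⟶x , _) with cutBefore x∈P pathP
      ... | inj₁ refl = contradiction y′⟶x y′↛p
      ... | inj₂ (P₁ , P₂ , _ , eq , path₁ , a , path₂) = shorten m
        (bypass path₁ (join path₂ p′⟶e pathE) pathY a e′⟶p e′⟶y y′⟶x
          (↭-trans (solve 4 (λ P Q E W → P ⊕ ((Q ⊕ E) ⊕ W) ⊜ (P ⊕ Q) ⊕ (E ⊕ W)) ↭-refl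
             P₁ P₂ E (Y ++ Z)) (subst (λ P → P ++ (E ++ (Y ++ Z)) ↭ L) eq partition))
          few)
        (shorter {P₁} {P₂} (length P₁) eq (subst (length P₁ <_) (sym (length-++ P₁ {P₂}))
          (m<m+n _ (path-nonempty path₂))))

      -- Leaving at `x` instead of `e′` moves the part of `P` up to `x` to the end of `E`; `p′↛y`
      -- excludes `x = p′`.
      fromP₂ : (∃ λ x → x ∈ P × p′ ⟶ x × x ⟶ y) → CycleMissing k
      fromP₂ (x , x∈P , _ , x⟶y) with cutAfter x∈P pathP
      ... | inj₁ refl = contradiction x⟶y p′↛y
      ... | inj₂ (P₁ , P₂ , _ , eq , path₁ , a , path₂) = shorten m
        (bypass path₂ (join pathE e′⟶p path₁) pathY p′⟶e a x⟶y y′⟶e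
          (↭-trans (solve 4 (λ P Q E W → Q ⊕ ((E ⊕ P) ⊕ W) ⊜ (P ⊕ Q) ⊕ (E ⊕ W)) ↭-refl
             P₁ P₂ E (Y ++ Z)) (subst (λ P → P ++ (E ++ (Y ++ Z)) ↭ L) eq partition))
          few)
        (shorter {P₁} {P₂} (length P₂) eq (subst (length P₂ <_) (sym (length-++ P₁ {P₂}))
          (m<n+m _ (path-nonempty path₁))))

      fromE₁ : (∃₂ λ E₁ E₂ → ∃₂ λ x x⁺ → E ≡ E₁ ++ E₂ × Path E₁ e x × x ⟶ y × y′ ⟶ x⁺ × Path E₂ x⁺ e′) →
        CycleMissing k
      fromE₁ (E₁ , E₂ , _ , _ , refl , path₁ , x⟶y , y′⟶x⁺ , path₂) =
        cycle (join pathP p′⟶e (join path₁ x⟶y (join pathY y′⟶x⁺ path₂))) e′⟶p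
          (↭-trans (solve 5 (λ P E F Y Z → (P ⊕ (E ⊕ (Y ⊕ F))) ⊕ Z ⊜ P ⊕ ((E ⊕ F) ⊕ (Y ⊕ Z)))
             ↭-refl P E₁ E₂ Y Z) partition)
          (fewer ↭-refl pathY few)

      -- `P` moves into `E`, and `Y` takes its former place between `e′` and `e`.
      fromE₂ : (∃₂ λ E₁ E₂ → ∃₂ λ x x⁺ → E ≡ E₁ ++ E₂ × Path E₁ e x × x ⟶ p × p′ ⟶ x⁺ × Path E₂ x⁺ e′) →
        CycleMissing k
      fromE₂ (E₁ , E₂ , _ , _ , refl , path₁ , x⟶p , p′⟶x⁺ , path₂) =
        cycle (join path₁ x⟶p (join pathP p′⟶x⁺ (join path₂ e′⟶y pathY))) y′⟶e
          (↭-trans (solve 5 (λ P E F Y Z → (E ⊕ (P ⊕ (F ⊕ Y))) ⊕ Z ⊜ P ⊕ ((E ⊕ F) ⊕ (Y ⊕ Z)))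
             ↭-refl P E₁ E₂ Y Z) partition)
          (fewer ↭-refl pathY few)

      -- The initial part of `Y` up to `x` already gains a vertex; the rest joins `Z`.
      fromY₁ : (∃ λ x → x ∈ Y × y′ ⟶ x × x ⟶ p) → CycleMissing k
      fromY₁ (x , x∈Y , _ , x⟶p) with prefixTo x∈Y pathY
      ... | Y₁ , Y₂ , refl , path₁ =
        cycle (join pathE e′⟶y (join path₁ x⟶p pathP)) p′⟶e
          (↭-trans (solve 5 (λ P E Y V Z → (E ⊕ (Y ⊕ P)) ⊕ (V ⊕ Z) ⊜ P ⊕ (E ⊕ ((Y ⊕ V) ⊕ Z)))
             ↭-refl P E Y₁ Y₂ Z) partition)
          (fewer (solve 3 (λ Y V Z → (Y ⊕ V) ⊕ Z ⊜ Y ⊕ (V ⊕ Z)) ↭-refl Y₁ Y₂ Z) path₁ few)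

      fromY₂ : (∃ λ x → x ∈ Y × p′ ⟶ x × x ⟶ y) → CycleMissing k
      fromY₂ (x , x∈Y , p′⟶x , _) with suffixFrom x∈Y pathY
      ... | Y₁ , Y₂ , refl , path₂ =
        cycle (join pathP p′⟶x (join path₂ y′⟶e pathE)) e′⟶p
          (↭-trans (solve 5 (λ P E Y V Z → (P ⊕ (V ⊕ E)) ⊕ (Y ⊕ Z) ⊜ P ⊕ (E ⊕ ((Y ⊕ V) ⊕ Z)))
             ↭-refl P E Y₁ Y₂ Z) partition)
          (fewer (solve 3 (λ Y V Z → (Y ⊕ V) ⊕ Z ⊜ V ⊕ (Y ⊕ Z)) ↭-refl Y₁ Y₂ Z) path₂ few)

      -- The vertex `x` links the end of `Y` to the start of `P`, so it joins the cycle together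
      -- with all of `Y`.
      fromZ₁ : (∃ λ x → x ∈ Z × y′ ⟶ x × x ⟶ p) → CycleMissing k
      fromZ₁ (x , x∈Z , y′⟶x , x⟶p) with ∈-∃++ x∈Z
      ... | Z₁ , Z₂ , refl =
        cycle (join pathE e′⟶y (join pathY⁺ x⟶p pathP)) p′⟶e
          (↭-trans (solve 6 (λ P E Y Z x V → (E ⊕ ((Y ⊕ x) ⊕ P)) ⊕ (Z ⊕ V) ⊜ P ⊕ (E ⊕ (Y ⊕ (Z ⊕ (x ⊕ V)))))
             ↭-refl P E Y Z₁ [ x ] Z₂) partition)
          (fewer (solve 4 (λ Y Z x V → Y ⊕ (Z ⊕ (x ⊕ V)) ⊜ (Y ⊕ x) ⊕ (Z ⊕ V)) ↭-refl Y Z₁ [ x ] Z₂)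
            pathY⁺ few)
        where pathY⁺ = join pathY y′⟶x only

      fromZ₂ : (∃ λ x → x ∈ Z × p′ ⟶ x × x ⟶ y) → CycleMissing k
      fromZ₂ (x , x∈Z , p′⟶x , x⟶y) with ∈-∃++ x∈Z
      ... | Z₁ , Z₂ , refl =
        cycle (join pathP p′⟶x (join pathY⁺ y′⟶e pathE)) e′⟶p
          (↭-trans (solve 6 (λ P E Y Z x V → (P ⊕ ((x ⊕ Y) ⊕ E)) ⊕ (Z ⊕ V) ⊜ P ⊕ (E ⊕ (Y ⊕ (Z ⊕ (x ⊕ V)))))
             ↭-refl P E Y Z₁ [ x ] Z₂) partition)
          (fewer (solve 4 (λ Y Z x V → Y ⊕ (Z ⊕ (x ⊕ V)) ⊜ (x ⊕ Y) ⊕ (Z ⊕ V)) ↭-refl Y Z₁ [ x ] Z₂)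
            pathY⁺ few)
        where pathY⁺ = x⟶y ∷ pathY

    -- A detour returning at `c⁺` is simply inserted. Otherwise the vertices before `c′` form the
    -- gap of a bypass; the detour may even return to `c` itself.
    attach : ∀ {C Y Z c c⁺ c′ y y′} → Path C c⁺ c → c ⟶ c⁺ →
      Path Y y y′ → c ⟶ y → c′ ∈ C → y′ ⟶ c′ →
      C ++ (Y ++ Z) ↭ L → length (Y ++ Z) ≤ suc k → CycleMissing k
    attach {C = C} {Y} {Z} pathC c⟶c⁺ pathY c⟶y c′∈C y′⟶c′ partition few
      with cutBefore c′∈C pathC
    ... | inj₁ refl =
      cycle (join pathC c⟶y pathY) y′⟶c′
        (↭-trans (solve 3 (λ C Y Z → (C ⊕ Y) ⊕ Z ⊜ C ⊕ (Y ⊕ Z)) ↭-refl C Y Z) partition)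
        (fewer ↭-refl pathY few)
    ... | inj₂ (P , E , _ , refl , pathP , a , pathE) =
      shorten (length P)
        (bypass pathP pathE pathY a c⟶c⁺ c⟶y y′⟶c′
          (↭-trans (solve 3 (λ P E W → P ⊕ (E ⊕ W) ⊜ (P ⊕ E) ⊕ W) ↭-refl P E (Y ++ Z)) partition)
          few)
        ≤-refl

    module _ {C R u v} (pathC : Path C u v) (v⟶u : v ⟶ u) (partition : C ++ R ↭ L) where

      private
        locate : w ∈ L → w ∈ C ⊎ w ∈ R
        locate w∈L = ∈-++⁻ C (∈-resp-↭ (↭-sym partition) w∈L)

      -- If `u ⟶ t` fails, a path `u`, `w`, `t` must leave the cycle by one of its two arcs.
      departure : t ∈ R → ∃₂ λ c z → c ∈ C × z ∈ R × c ⟶ z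
      departure {t} t∈R with u ⟶? t
      ... | yes u⟶t = u , t , start∈ pathC , t∈R , u⟶t
      ... | no u↛t with between u↛t
      ...   | w , w∈L , u⟶w , w⟶t with locate w∈L
      ...     | inj₁ w∈C = w , t , w∈C , t∈R , w⟶t
      ...     | inj₂ w∈R = u , w , start∈ pathC , w∈R , u⟶w

      enlarge : t ∈ R → length R ≤ suc k → CycleMissing k
      enlarge {k = k} t∈R few with departure t∈R
      ... | c , z , c∈C , z∈R , c⟶z with rotate c∈C pathC v⟶u | extract z∈R
      ...   | C′ , c⁺ , pathC′ , c⟶c⁺ , C′↭C | R′ , R↭ = result
        where
        detour : ∀ {Y Z c′ z′} → Path Y z z′ → c′ ∈ C → z′ ⟶ c′ → R ↭ Y ++ Z → CycleMissing k
        detour pathY c′∈C z′⟶c′ R↭ =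
          attach pathC′ c⟶c⁺ pathY c⟶z (∈-resp-↭ (↭-sym C′↭C) c′∈C) z′⟶c′
            (↭-trans (++⁺ C′↭C (↭-sym R↭)) partition)
            (subst (_≤ suc k) (↭-length R↭) few)

        result : CycleMissing k
        result with z ⟶? c
        ... | yes z⟶c = detour only c∈C z⟶c R↭
        -- The way back to `c` passes through one vertex `w`: on the cycle, `w` is where the detour
        -- returns; off it, `w` is its second vertex.
        ... | no z↛c with between z↛c
        ...   | w , w∈L , z⟶w , w⟶c with locate w∈L
        ...     | inj₁ w∈C = detour only w∈C z⟶w R↭
        ...     | inj₂ w∈R with ∈-resp-↭ R↭ w∈R
        ...       | here refl = contradiction w⟶c z↛c
        ...       | there w∈R′ with extract w∈R′
        ...         | R″ , R′↭ = detour (z⟶w ∷ only) c∈C w⟶c (↭-trans R↭ (prep z R′↭))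

    someCycle : u ∈ L → ∃ CycleMissing
    someCycle {u} u∈L with u ⟶? u | extract u∈L
    ... | yes u⟶u | R , L↭ = _ , cycle only u⟶u (↭-sym L↭) ≤-refl
    ... | no u↛u | R , L↭ with between u↛u
    ...   | w , w∈L , u⟶w , w⟶u with ∈-resp-↭ L↭ w∈L
    ...     | here refl = contradiction u⟶w u↛u
    ...     | there w∈R with extract w∈R
    ...       | R′ , R↭ =
      _ , cycle (u⟶w ∷ only) w⟶u (↭-sym (↭-trans L↭ (prep u R↭))) ≤-refl

    Hamiltonian : Set
    Hamiltonian = ∃ λ C → ∃₂ λ u v → Path C u v × v ⟶ u × C ↭ L

    -- Each enlargement lowers `k`, and at `k = 0` the bound `few` leaves `off` empty.
    complete : ∀ k → CycleMissing k → Hamiltonian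
    complete k (cycle {on} {[]} path close partition few) =
      on , _ , _ , path , close , ↭-trans (↭-sym (++-identityʳ on)) partition
    complete (suc k) (cycle {off = _ ∷ _} path close partition few) =
      complete k (enlarge path close partition (here refl) few)

    hamiltonian : u ∈ L → Hamiltonian
    hamiltonian u∈L with someCycle u∈L
    ... | k , c = complete k c

-- Lists without repetition and cardinalities of subsets

filter-++-filter-↭ : ∀ {A : Set} {P Q : Pred A 0ℓ} (P? : Decidable P) (Q? : Decidable Q) →
  (∀ x → P x ⊎ Q x) → (∀ x → P x → ¬ Q x) → ∀ xs → filter P? xs ++ filter Q? xs ↭ xs
filter-++-filter-↭ P? Q? covers disjoint [] = ↭-refl
filter-++-filter-↭ P? Q? covers disjoint (x ∷ xs)
  with rest ← filter-++-filter-↭ P? Q? covers disjoint xs | P? x | Q? x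
... | yes Px | yes Qx = contradiction Qx (disjoint x Px)
... | yes _  | no _   = prep x rest
... | no _   | yes _  = ↭-trans (shift x (filter P? xs) (filter Q? xs)) (prep x rest)
... | no ¬Px | no ¬Qx with covers x
...   | inj₁ Px = contradiction Px ¬Px
...   | inj₂ Qx = contradiction Qx ¬Qx

unique-lookup-injective : ∀ {A : Set} {xs : List A} → Unique xs → Injective _≡_ _≡_ (lookup xs)
unique-lookup-injective (_ ∷ _) {zero} {zero} _ = refl
unique-lookup-injective {xs = _ ∷ xs} (x∉ ∷ _) {zero} {suc j} eq =
  contradiction eq (All.lookup x∉ (∈-lookup j))
unique-lookup-injective {xs = _ ∷ xs} (x∉ ∷ _) {suc i} {zero} eq =
  contradiction (sym eq) (All.lookup x∉ (∈-lookup i))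
unique-lookup-injective (_ ∷ u) {suc i} {suc j} eq = cong suc (unique-lookup-injective u eq)

-- The pointwise hypothesis covers both the colour classes and the tabulated neighbourhoods.
∣∣≡count : ∀ {n} {A : Set} {P : Pred A 0ℓ} (P? : Decidable P) (S : Subset n) (g : Fin n → A) →
  (∀ i → Vec.lookup S i ≡ does (P? (g i))) → ∣ S ∣ ≡ count P? (tabulate g)
∣∣≡count P? Vec.[] g same = refl
∣∣≡count P? (s Vec.∷ S) g same
  with ih ← ∣∣≡count P? S (g ∘ suc) (same ∘ suc) | s | P? (g zero) | same zero
... | true  | yes _ | _ = cong suc ih
... | false | no _  | _ = ih

lookup≡does-∈? : ∀ {n} (S : Subset n) i → Vec.lookup S i ≡ does (i ∈? S)
lookup≡does-∈? (true  Vec.∷ S) zero    = refl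
lookup≡does-∈? (false Vec.∷ S) zero    = refl
lookup≡does-∈? (_     Vec.∷ S) (suc i) = lookup≡does-∈? S i

-- Perfect matchings by augmentation

module Matching {B C : Set} (_⟶_ : B → C → Set) (_⟶?_ : ∀ x y → Dec (x ⟶ y))
  (Xs : List B) (Ys : List C) where

  -- Membership of the ends is stored so that the degree condition of the contraction holds for any
  -- two edges.
  record Edge : Set where
    constructor edge
    field
      {tail} : B
      {head} : C
      tail∈  : tail ∈ Xs
      head∈  : head ∈ Ys
      arc    : tail ⟶ head
  open Edge public

  -- `U` and `W` are the free vertices. Since `Xs` and `Ys` will have no repetitions, the
  -- permutations also keep the edges disjoint.
  record Matched (U : List B) (W : List C) : Set where
    constructor matched
    field
      edges : List Edge
      tails : map tail edges ++ U ↭ Xs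
      heads : map head edges ++ W ↭ Ys

  private variable
    U U′ : List B
    W W′ : List C
    x : B
    y : C

  module _ (m : Matched U W) where
    open Matched m

    free-tail : x ∈ U → x ∈ Xs
    free-tail x∈U = ∈-resp-↭ tails (∈-++⁺ʳ (map tail edges) x∈U)

    free-head : y ∈ W → y ∈ Ys
    free-head y∈W = ∈-resp-↭ heads (∈-++⁺ʳ (map head edges) y∈W)

    extend : x ∈ U → y ∈ W → U ↭ x ∷ U′ → W ↭ y ∷ W′ → x ⟶ y → Matched U′ W′
    extend {U′ = U′} {W′ = W′} x∈U y∈W U↭ W↭ x⟶y =
      matched (edge (free-tail x∈U) (free-head y∈W) x⟶y ∷ edges)
        (↭-trans (↭-sym (shift _ (map tail edges) U′))
          (↭-trans (++⁺ˡ (map tail edges) (↭-sym U↭)) tails))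
        (↭-trans (↭-sym (shift _ (map head edges) W′))
          (↭-trans (++⁺ˡ (map head edges) (↭-sym W↭)) heads))

  -- Removes a matched edge e, so that extend can put e's ends into two new edges.
  unmatch : ∀ {e} (m : Matched U W) → e ∈ Matched.edges m → Matched (tail e ∷ U) (head e ∷ W)
  unmatch {U} {W} {e} m e∈ with extract e∈
  ... | rest , edges↭ = matched rest
    (↭-trans (shift (tail e) (map tail rest) U)
      (↭-trans (++⁺ (↭-sym (map⁺ tail edges↭)) ↭-refl) (Matched.tails m)))
    (↭-trans (shift (head e) (map head rest) W)
      (↭-trans (++⁺ (↭-sym (map⁺ head edges↭)) ↭-refl) (Matched.heads m)))

  module _ (same-length : length Xs ≡ length Ys)
    (degree : ∀ {x y} → x ∈ Xs → y ∈ Ys → ¬ (x ⟶ y) →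
      length Xs < count (x ⟶?_) Ys + count (_⟶? y) Xs) where

    -- If neither `x` nor `y` has a suitable free neighbour, all neighbours counted lie on matched
    -- edges. Their number exceeds that of the edges, so some edge `e` has `x ⟶ head e` and
    -- `tail e ⟶ y`; these two arcs replace `e`.
    augment : Matched (x ∷ U) (y ∷ W) → ∃₂ λ U′ W′ → length U′ ≡ length U × Matched U′ W′
    augment {x} {U} {y} {W} m with any? (x ⟶?_) (y ∷ W) | any? (_⟶? y) (x ∷ U)
    ... | yes some | _ with find some
    ...   | w , w∈W , x⟶w with extract w∈W
    ...     | W′ , W↭ = U , W′ , refl , extend m (here refl) w∈W ↭-refl W↭ x⟶w
    augment {x} {U} {y} {W} m | no _ | yes some with find some
    ...   | u , u∈U , u⟶y with extract u∈U
    ...     | U′ , U↭ =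
      U′ , W , suc-injective (sym (↭-length U↭)) , extend m u∈U (here refl) U↭ ↭-refl u⟶y
    augment {x} {U} {y} {W} m@(matched edges tails heads) | no noHead | no noTail =
      U , W , refl , switch
        (common-exists (λ e → x ⟶? head e) (λ e → tail e ⟶? y) edges (begin-strict
          length edges ≡⟨ length-map tail edges ⟨
          length (map tail edges) ≤⟨ m≤m+n _ _ ⟩
          length (map tail edges) + length (x ∷ U) ≡⟨ length-++ (map tail edges) ⟨
          length (map tail edges ++ x ∷ U) ≡⟨ ↭-length tails ⟩
          length Xs <⟨ degree (free-tail m (here refl)) (free-head m (here refl)) (noHead ∘ here) ⟩
          count (x ⟶?_) Ys + count (_⟶? y) Xs
            ≡⟨ cong₂ _+_ (matched-only (x ⟶?_) heads noHead) (matched-only (_⟶? y) tails noTail) ⟩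
          count (λ e → x ⟶? head e) edges + count (λ e → tail e ⟶? y) edges ∎))
      where
      open ≤-Reasoning

      matched-only : ∀ {A : Set} {f : Edge → A} {zs Zs} {P : Pred A 0ℓ} (P? : Decidable P) →
        map f edges ++ zs ↭ Zs → ¬ Any P zs →
        count P? Zs ≡ count (λ e → P? (f e)) edges
      matched-only {f = f} {zs} P? Zs↭ none = trans (sym (count-↭ P? Zs↭))
        (trans (count-++ P? (map f edges) zs)
        (trans (cong₂ _+_ (count-map P? f edges) (count-none P? (¬Any⇒All¬ zs none)))
        (+-identityʳ _)))

      switch : (∃ λ e → e ∈ edges × x ⟶ head e × tail e ⟶ y) → Matched U W
      switch (e , e∈ , x⟶h , t⟶y) =
        extend (extend (unmatch m e∈) (there (here refl)) (here refl)
                  (swap _ _ ↭-refl) ↭-refl x⟶h)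
          (here refl) (here refl) ↭-refl ↭-refl t⟶y

    free-lengths : Matched U W → length U ≡ length W
    free-lengths (matched edges tails heads) = +-cancelˡ-≡ (length edges) _ _
      (trans (split tail tails) (trans same-length (sym (split head heads))))
      where
      split : ∀ {A : Set} (f : Edge → A) {zs Zs} → map f edges ++ zs ↭ Zs →
        length edges + length zs ≡ length Zs
      split f {zs} Zs↭ = trans (cong (_+ length zs) (sym (length-map f edges)))
        (trans (sym (length-++ (map f edges))) (↭-length Zs↭))

    -- The recursion is on `n` because `augment` may return a list `U′` that is not a tail of the
    -- old one.
    matchAll : ∀ n → length U ≡ n → Matched U W → Matched [] []
    matchAll {[]} {[]} _ _ m = m
    matchAll {[]} {_ ∷ _} _ _ m = contradiction (free-lengths m) λ ()
    matchAll {_ ∷ _} {[]} _ _ m = contradiction (free-lengths m) λ ()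
    matchAll {x ∷ U} {y ∷ W} (suc n) eq m with augment m
    ... | U′ , W′ , U′≡ , m′ = matchAll n (trans U′≡ (suc-injective eq)) m′

    perfectMatching : Matched [] []
    perfectMatching = matchAll (length Xs) refl (matched [] ↭-refl ↭-refl)

-- Oriented cycles from closed paths

module _ (D : Digraph) where
  open Digraph D
  open Woodall _⟶_ _⟶?_ using (Path; only; _∷_; path-nonempty)

  private variable
    xs : List Vertex
    u v : Vertex

  path-first : Path xs u v → ∀ i → toℕ i ≡ 0 → lookup xs i ≡ u
  path-first only    zero _ = refl
  path-first (_ ∷ _) zero _ = refl

  path-step : Path xs u v → ∀ i j → toℕ j ≡ suc (toℕ i) → lookup xs i ⟶ lookup xs j
  path-step only    zero    zero    ()
  path-step (a ∷ p) zero    (suc j) eq =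
    subst (_ ⟶_) (sym (path-first p j (suc-injective eq))) a
  path-step (_ ∷ p) (suc i) (suc j) eq = path-step p i j (suc-injective eq)

  path-last : Path xs u v → ∀ i → suc (toℕ i) ≡ length xs → lookup xs i ≡ v
  path-last only    zero    _  = refl
  path-last (_ ∷ p) zero    eq = contradiction (path-nonempty p) (<⇒≱ (≤-reflexive (sym eq)))
  path-last (_ ∷ p) (suc i) eq = path-last p i (suc-injective eq)

  orientedCycle : Path xs u v → v ⟶ u → Unique xs → OrientedCycle D (length xs)
  orientedCycle {xs} p v⟶u unique = record
    { nonEmpty = >-nonZero (path-nonempty p)
    ; vertex   = lookup xs
    ; distinct = unique-lookup-injective unique
    ; step     = path-step p
    ; close    = λ first last first≡ last≡ →
        subst₂ _⟶_ (sym (path-last p last last≡)) (sym (path-first p first first≡)) v⟶u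
    }

  -- Contracting the matching and expanding its Hamiltonian cycle

  module _ (X Y : Subset order) (bipartition : IsBipartition D X Y) where
    open IsBipartition bipartition

    Xs Ys : List Vertex
    Xs = filter (_∈? X) (allFin order)
    Ys = filter (_∈? Y) (allFin order)

    classes-↭ : Xs ++ Ys ↭ allFin order
    classes-↭ = filter-++-filter-↭ (_∈? X) (_∈? Y) covers disjoint (allFin order)

    length-class : ∀ S → length (filter (_∈? S) (allFin order)) ≡ ∣ S ∣
    length-class S = sym (∣∣≡count (_∈? S) S id (lookup≡does-∈? S))

    class-∈ : ∀ {S} → v ∈ filter (_∈? S) (allFin order) → v Subset.∈ S
    class-∈ {S = S} v∈ = proj₂ (∈-filter⁻ (_∈? S) {xs = allFin order} v∈)

    module _ {P : Pred Vertex 0ℓ} (P? : Decidable P) where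

      count-classes : ∣ Vec.tabulate (does ∘ P?) ∣ ≡ count P? Xs + count P? Ys
      count-classes = trans (∣∣≡count P? (Vec.tabulate (does ∘ P?)) id (lookup∘tabulate _))
        (trans (sym (count-↭ P? classes-↭)) (count-++ P? Xs Ys))

      count-in-X : (∀ {v} → v Subset.∈ Y → ¬ P v) → ∣ Vec.tabulate (does ∘ P?) ∣ ≡ count P? Xs
      count-in-X none = trans count-classes (trans
        (cong (count P? Xs +_) (count-none P? (All.map none (all-filter (_∈? Y) (allFin order)))))
        (+-identityʳ _))

      count-in-Y : (∀ {v} → v Subset.∈ X → ¬ P v) → ∣ Vec.tabulate (does ∘ P?) ∣ ≡ count P? Ys
      count-in-Y none = trans count-classes (cong (_+ count P? Ys)
        (count-none P? (All.map none (all-filter (_∈? X) (allFin order)))))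

    open Matching _⟶_ _⟶?_ Xs Ys

    -- A loop `e ⇒ e` is an arc back from `head e` to `tail e`, a two-cycle of the digraph.
    _⇒_ : Rel Edge 0ℓ
    e ⇒ f = head e ⟶ tail f

    module Contracted = Woodall _⇒_ (λ e f → head e ⟶? tail f)

    endpoints : List Edge → List Vertex
    endpoints = concatMap λ e → tail e ∷ head e ∷ []

    -- Matching arcs alternate with the arcs behind `_⇒_`; a closing arc of the contracted path is
    -- also one of the expanded path.
    endpoints-path : ∀ {es e f} → Contracted.Path es e f → Path (endpoints es) (tail e) (head f)
    endpoints-path {e = e} Contracted.only      = arc e ∷ only
    endpoints-path {e = e} (a Contracted.∷ p) = arc e ∷ (a ∷ endpoints-path p)

    endpoints-↭ : ∀ es → endpoints es ↭ map tail es ++ map head es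
    endpoints-↭ []       = ↭-refl
    endpoints-↭ (e ∷ es) = prep (tail e) (↭-trans (prep (head e) (endpoints-↭ es))
      (↭-sym (shift (head e) (map tail es) (map head es))))

    module _ {a : ℕ} (a≥2 : a ≥ 2) (∣X∣≡a : ∣ X ∣ ≡ a) (∣Y∣≡a : ∣ Y ∣ ≡ a)
      (condition : ConditionA*₂ D a X Y) where

      length-Xs : length Xs ≡ a
      length-Xs = trans (length-class X) ∣X∣≡a

      length-Ys : length Ys ≡ a
      length-Ys = trans (length-class Y) ∣Y∣≡a

      degree-XY : ∀ {x y} → x ∈ Xs → y ∈ Ys → ¬ (x ⟶ y) →
        a + 2 ≤ count (x ⟶?_) Ys + count (_⟶? y) Xs
      degree-XY {x} {y} x∈ y∈ x↛y = subst (a + 2 ≤_)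
        (cong₂ _+_ (count-in-Y (x ⟶?_) (noArcX (class-∈ x∈)))
                   (count-in-X (_⟶? y) (λ v∈ → noArcY v∈ (class-∈ y∈))))
        (condition x y (inj₁ (class-∈ x∈ , class-∈ y∈)) x↛y)

      -- This half of the condition governs the contraction, while `degree-XY` provides the
      -- matching.
      degree-YX : ∀ {x y} → x ∈ Xs → y ∈ Ys → ¬ (y ⟶ x) →
        a + 2 ≤ count (y ⟶?_) Xs + count (_⟶? x) Ys
      degree-YX {x} {y} x∈ y∈ y↛x = subst (a + 2 ≤_)
        (cong₂ _+_ (count-in-X (y ⟶?_) (noArcY (class-∈ y∈)))
                   (count-in-Y (_⟶? x) (λ v∈ → noArcX v∈ (class-∈ x∈))))
        (condition y x (inj₂ (class-∈ y∈ , class-∈ x∈)) y↛x)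

      hamiltonianCycle : OrientedCycle D (2 * a)
      hamiltonianCycle
        with perfectMatching (trans length-Xs (sym length-Ys))
               (λ x∈ y∈ x↛y → <-≤-trans (≤-<-trans (≤-reflexive length-Xs) (m<m+n a (s≤s z≤n)))
                                (degree-XY x∈ y∈ x↛y))
      ... | matched edges tails heads = build edges (≤-trans a≥2 (≤-reflexive (sym length-edges))) hamilton
        where
        tails′ : map tail edges ↭ Xs
        tails′ = ↭-trans (↭-sym (++-identityʳ _)) tails

        heads′ : map head edges ↭ Ys
        heads′ = ↭-trans (↭-sym (++-identityʳ _)) heads

        length-edges : length edges ≡ a
        length-edges = trans (sym (length-map tail edges)) (trans (↭-length tails′) length-Xs)

        -- A perfect matching identifies its edges with `Xs` through `tail` and with `Ys` through
        -- `head`, so counts over edges are counts over a class.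
        degree : ∀ e f → ¬ (e ⇒ f) → length edges + 2 ≤
          count (λ g → head e ⟶? tail g) edges + count (λ g → head g ⟶? tail f) edges
        degree e f e⇏f = subst₂ _≤_ (cong (_+ 2) (sym length-edges))
          (cong₂ _+_ (via (head e ⟶?_) tail tails′) (via (_⟶? tail f) head heads′))
          (degree-YX (tail∈ f) (head∈ e) e⇏f)
          where
          via : ∀ {P : Pred Vertex 0ℓ} (P? : Decidable P) (g : Edge → Vertex) {zs} →
            map g edges ↭ zs → count P? zs ≡ count (P? ∘ g) edges
          via P? g zs↭ = trans (sym (count-↭ P? zs↭)) (count-map P? g edges)

        hamilton : ∀ {e} → e ∈ edges → Contracted.Hamiltonian edges degree
        hamilton = Contracted.hamiltonian edges degree

        -- Splitting `es`, which stands for `edges`, supplies an edge to start from; the length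
        -- bound excludes the empty list.
        build : ∀ es → 2 ≤ length es → (∀ {e} → e ∈ es → Contracted.Hamiltonian edges degree) →
          OrientedCycle D (2 * a)
        build (e ∷ es) _ hamilton with hamilton (here refl)
        ... | cyc , _ , _ , path , close , cyc↭ =
          -- Distinctness enters here: the expanded cycle is a permutation of `allFin order`.
          subst (OrientedCycle D) length-all
            (orientedCycle (endpoints-path path) close
              (Permutation.Unique-resp-↭ (setoid Vertex) (↭⇒↭ₛ (↭-sym all↭)) (allFin⁺ order)))
          where
          classes : endpoints cyc ↭ Xs ++ Ys
          classes = ↭-trans (endpoints-↭ cyc)
            (++⁺ (↭-trans (map⁺ tail cyc↭) tails′) (↭-trans (map⁺ head cyc↭) heads′))

          all↭ : endpoints cyc ↭ allFin order
          all↭ = ↭-trans classes classes-↭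

          length-all : length (endpoints cyc) ≡ 2 * a
          length-all = trans (↭-length classes) (trans (length-++ Xs)
            (cong₂ _+_ length-Xs (trans length-Ys (sym (+-identityʳ a)))))

theorem1p2 : (a : ℕ) → a ≥ 2 →
    (D : Digraph) (X Y : Subset (Digraph.order D)) →
    IsBipartition D X Y → ∣ X ∣ ≡ a → ∣ Y ∣ ≡ a →
    ConditionA*₂ D a X Y →
    OrientedCycle D (2 * a)
theorem1p2 a a≥2 D X Y bipartition = hamiltonianCycle D X Y bipartition a≥2
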